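{- Let $U$ be a totally ordered universe of integers and let $A\subseteq U$ be a set of $n$ integers stored in sorted order $A[1]<A[2]<\dots<A[n]$. Fix an integer $k=O(n)$ and let $D_k$ be the Binning Learned version of a dictionary ${\cal SD}$ built on $A$ with $k$ bins (as described in the context). Let $\Delta=G_{\max}/G_{\min}$ be the gap ratio of $A$. Assume that ${\cal SD}$ can be built in $O(c\,g(c))$ time on $c$ elements, where $g$ is convex and non-decreasing, and that searching in ${\cal SD}$ can be done in $O(f(c))$ time when it contains $c$ elements. Then $D_k$ can be built in $O(n\,g(n))$ time, and, given any element $x\in U$, the time to search for $x$ in $D_k$ is $O\!\left(f\!\left(\min\left(n,\frac{n\Delta}{k}\right)\right)\right)$.
   Context: A (static sorted set) dictionary ${\cal SD}$ over a sorted set $A\subseteq U$ supports $search(x)$, returning TRUE iff $x\in A$. Binning construction $D_k$: the range $[A[1],A[n]]$ of the universe is divided into $k$ consecutive bins $B_1,\dots,B_k$, each representing a range of integers of size $\frac{A[n]-A[1]}{k}$; each bin is associated with the (sorted) elements of $A$ falling into its range. For each bin a separate copy of ${\cal SD}$ is built containing exactly the elements of $A$ in that bin, and an auxiliary array of length $k$ stores in its $j$-th entry a pointer to the structure of bin $j$ (possibly empty). To query $x\in U$, one computes the bin index $i=\left\lceil \frac{(x-A[1])k}{A[n]-A[1]}\right\rceil$ and searches for $x$ in the ${\cal SD}$ of bin $i$. The gap ratio is $\Delta=\frac{G_{\max}}{G_{\min}}$, where $G_{\max}$ and $G_{\min}$ are the maximum and minimum distance $A[i+1]-A[i]$ between consecutive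 elements of $A$ (so $G_{\min}>0$).
   Formalization: f is assumed non-decreasing and the search bound is read as f(⌈min(n, nΔ/k)⌉), since the claim fails for non-monotone f and, without rounding up, for fast-growing f; also n ≥ 2, k ≥ 1, and bin indices outside 1..k go to the nearest bin. -}

module Defs where

open import Algebra.Bundles using (CommutativeRing)
open import Data.Bool.Base using (Bool; false; T)
open import Data.Fin.Base as Fin using (Fin; zero; suc; fromℕ; fromℕ<; toℕ; inject₁)
open import Data.Fin.Properties using (toℕ-inject₁)
open import Data.Integer.Base as ℤ using (ℤ; +_; 1ℤ; ∣_∣)
import Data.Integer.Properties as ℤ
open import Data.List.Base using (List; []; _∷_; length; tabulate)
open import Data.List.Extrema.Nat using (max; min; v<min⁺)
open import Data.List.Membership.Propositional using (_∈_)
open import Data.List.Relation.Unary.All using (All)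
open import Data.List.Relation.Unary.All.Properties using (tabulate⁺)
open import Data.List.Relation.Unary.AllPairs using (AllPairs)
open import Data.Maybe.Base using (Maybe; just; nothing)
open import Data.Nat.Base as ℕ using (ℕ; zero; suc; pred; NonZero; s≤s)
import Data.Nat.Properties as ℕ
open import Data.Product.Base using (_×_; _,_; ∃-syntax)
open import Data.Rational.Unnormalised.Base as ℚᵘ using (ℚᵘ; _/_; ceiling)
open import Data.Vec.Base using (Vec; []; _∷_; lookup)
open import Data.Vec.Functional using (Vector)
open import Function.Bundles using (_⇔_)
open import Level using (Level; _⊔_) renaming (suc to lsuc)
open import Relation.Binary.Core using (Rel; _Preserves_⟶_)
open import Relation.Binary.PropositionalEquality using (_≡_; _≢_; sym)
open import Relation.Binary.Structures using (IsPartialOrder)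
open import Relation.Nullary.Decidable using (yes; no)
open import Relation.Unary using (Pred)

------------------------------------------------------------------------
-- Time bounds

-- Stands in for the field of real numbers in which time bounds take their
-- values: ℝ satisfies these axioms, and so do ℚ and ℤ.  The order is not
-- required to be total, so that constructive reals are included.
record OrderedRing c ℓ₁ ℓ₂ : Set (lsuc (c ⊔ ℓ₁ ⊔ ℓ₂)) where
  infix 4 _≤_
  field
    commutativeRing : CommutativeRing c ℓ₁
  open CommutativeRing commutativeRing public
  field
    _≤_            : Rel Carrier ℓ₂
    isPartialOrder : IsPartialOrder _≈_ _≤_
    0≤1            : 0# ≤ 1#
    +-monoˡ-≤      : ∀ z {x y} → x ≤ y → x + z ≤ y + z
    *-nonNeg       : ∀ {x y} → 0# ≤ x → 0# ≤ y → 0# ≤ x * y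

  ι : ℕ → Carrier
  ι zero    = 0#
  ι (suc n) = 1# + ι n

module _ {c ℓ₁ ℓ₂} (R : OrderedRing c ℓ₁ ℓ₂) where
  open OrderedRing R

  NonDecreasing : (ℕ → Carrier) → Set ℓ₂
  NonDecreasing h = ∀ {x y} → x ℕ.≤ y → h x ≤ h y

  -- h (t x + (1 - t) y) ≤ t h(x) + (1 - t) h(y) with t = p / (p + q),
  -- multiplied by p + q, whenever t x + (1 - t) y is a natural number z.
  Convex : (ℕ → Carrier) → Set ℓ₂
  Convex h = ∀ p q x y z → (p ℕ.+ q) ℕ.* z ≡ p ℕ.* x ℕ.+ q ℕ.* y →
    ι (p ℕ.+ q) * h z ≤ ι p * h x + ι q * h y

  -- t = O(h), uniformly over the index type I of all problem instances.
  BigO : ∀ {i} {I : Set i} → (I → ℕ) → (I → Carrier) → Set (i ⊔ c ⊔ ℓ₂)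
  BigO {I = I} t h = ∃[ C ] 0# ≤ C × (∀ (p : I) → ι (t p) ≤ C * h p)

------------------------------------------------------------------------
-- Timed computations

infix 3 _after_

record Timed (X : Set) : Set where
  constructor _after_
  field
    value : X
    time  : ℕ

open Timed public

infixl 1 _>>=_

_>>=_ : ∀ {X Y} → Timed X → (X → Timed Y) → Timed Y
m >>= f = value (f (value m)) after time m ℕ.+ time (f (value m))

-- One elementary operation of a unit-cost RAM.
step : ∀ {X} → X → Timed X
step x = x after 1

------------------------------------------------------------------------
-- Dictionaries

StrictlySorted : List ℤ → Set
StrictlySorted = AllPairs ℤ._<_

-- Sets are given to build as sorted lists; nothing but a positive running
-- time is required of build and search on other inputs.
record Dictionary (U : Pred ℤ Level.zero) : Set₁ where
  field
    Structure   : Set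
    build       : List ℤ → Timed Structure
    search      : Structure → ℤ → Timed Bool
    correct     : ∀ {xs} → StrictlySorted xs → All U xs → ∀ {x} → U x →
                  T (value (search (value (build xs)) x)) ⇔ x ∈ xs
    build-time  : ∀ xs → 1 ℕ.≤ time (build xs)
    search-time : ∀ s x → 1 ℕ.≤ time (search s x)

record NonEmptySet (U : Pred ℤ Level.zero) : Set where
  field
    elements : List ℤ
    nonEmpty : elements ≢ []
    sorted   : StrictlySorted elements
    inU      : All U elements

  size : ℕ
  size = length elements

record Query (U : Pred ℤ Level.zero) : Set where
  field
    key : ℤ
    inU : U key

module _ {c ℓ₁ ℓ₂} (R : OrderedRing c ℓ₁ ℓ₂) {U : Pred ℤ Level.zero} (SD : Dictionary U) where
  open OrderedRing R using (Carrier)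
  open Dictionary SD
  open NonEmptySet using (elements; size)
  open Query using (key)

  BuildTime : (ℕ → Carrier) → Set (c ⊔ ℓ₂)
  BuildTime h = BigO R {I = NonEmptySet U}
    (λ S → time (build (elements S)))
    (λ S → h (size S))

  SearchTime : (ℕ → Carrier) → Set (c ⊔ ℓ₂)
  SearchTime h = BigO R {I = NonEmptySet U × Query U}
    (λ (S , q) → time (search (value (build (elements S))) (key q)))
    (λ (S , q) → h (size S))

------------------------------------------------------------------------
-- Sorted arrays and their gaps

-- The array entry A[i] is at i - 1.  At least two entries are
-- needed for the gaps, and for A[n] - A[1] to be non-zero.
record SortedArray (U : Pred ℤ Level.zero) : Set where
  field
    {n-2}  : ℕ

  n : ℕ
  n = suc (suc n-2)

  field
    A      : Vector ℤ n
    sorted : A Preserves Fin._<_ ⟶ ℤ._<_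
    inU    : ∀ i → U (A i)

  A₁ Aₙ : ℤ
  A₁ = A zero
  Aₙ = A (fromℕ (suc n-2))

  range : ℕ
  range = ∣ Aₙ ℤ.- A₁ ∣

  gap : Fin (suc n-2) → ℕ
  gap i = ∣ A (suc i) ℤ.- A (inject₁ i) ∣

  G-max G-min : ℕ
  G-max = max (gap zero) (tabulate gap)
  G-min = min (gap zero) (tabulate gap)

  private
    distance>0 : ∀ {x y} → x ℤ.< y → 0 ℕ.< ∣ y ℤ.- x ∣
    distance>0 {x} {y} x<y = ℕ.n≢0⇒n>0 λ eq →
      ℤ.<⇒≢ x<y (sym (ℤ.i-j≡0⇒i≡j y x (ℤ.∣i∣≡0⇒i≡0 eq)))

    gap>0 : ∀ i → 0 ℕ.< gap i
    gap>0 i = distance>0 (sorted (s≤s (ℕ.≤-reflexive (toℕ-inject₁ i))))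

  instance
    range-nonZero : NonZero range
    range-nonZero = ℕ.>-nonZero (distance>0 (sorted (s≤s ℕ.z≤n)))

    G-min-nonZero : NonZero G-min
    G-min-nonZero = ℕ.>-nonZero (v<min⁺ (gap>0 zero) (tabulate⁺ gap>0))

  Δ : ℚᵘ
  Δ = + G-max / G-min

------------------------------------------------------------------------
-- Binning

-- The bin numbered i (1 ≤ i ≤ k) is at i - 1; other indices go to the
-- nearest bin.
clamp : ∀ k .{{_ : NonZero k}} → ℤ → Fin k
clamp (suc k) i = fromℕ< {pred ∣ i ℤ.⊔ 1ℤ ∣ ℕ.⊓ k} (s≤s (ℕ.m⊓n≤n _ k))

module Binning {U : Pred ℤ Level.zero} (SD : Dictionary U)
               (𝐀 : SortedArray U) (k : ℕ) .{{_ : NonZero k}} where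
  open SortedArray 𝐀
  private module SD = Dictionary SD

  -- The formula yields 0 for x = A[1], which is thus clamped into the first
  -- bin.
  bin : ℤ → Fin k
  bin x = clamp k (ceiling (((x ℤ.- A₁) ℤ.* + k) / range))

  -- Two array accesses, two subtractions, a multiplication, a division
  -- rounding up, and two comparisons and a decrement in clamp.
  computeBin : ℤ → Timed (Fin k)
  computeBin x = bin x after 9

  -- An empty bin is represented by a null pointer.
  Structure : Set
  Structure = Vec (Maybe SD.Structure) k

  -- Cuts off the longest prefix of elements in the j-th bin.
  takeBin : ℕ → List ℤ → Timed (List ℤ × List ℤ)
  takeBin j []       = step ([] , [])
  takeBin j (a ∷ as) =
    computeBin a          >>= λ i →
    step (toℕ i ℕ.≟ j)    >>= λ where
      (yes _) → takeBin j as >>= λ (here , later) → step (a ∷ here , later)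
      (no  _) → step ([] , a ∷ as)

  buildBin : List ℤ → Timed (Maybe SD.Structure)
  buildBin []         = step nothing
  buildBin as@(_ ∷ _) = SD.build as >>= λ s → step (just s)

  -- Builds the r bins starting at j out of the sorted elements not yet
  -- placed, with one step for writing each array entry.
  buildBins : ∀ r (j : ℕ) → List ℤ → Timed (Vec (Maybe SD.Structure) r)
  buildBins zero    j as = step []
  buildBins (suc r) j as =
    takeBin j as                >>= λ (here , later) →
    buildBin here               >>= λ s →
    buildBins r (suc j) later   >>= λ ss →
    step (s ∷ ss)

  build : Timed Structure
  build = buildBins k 0 (tabulate A)

  searchBin : Maybe SD.Structure → ℤ → Timed Bool
  searchBin nothing  x = step false
  searchBin (just s) x = SD.search s x

  search : Structure → ℤ → Timed Bool
  search D x =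
    computeBin x        >>= λ i →
    step (lookup D i)   >>= λ p →
    searchBin p x

-- A sorted array together with a number of bins k ≤ K n.
record Instance (U : Pred ℤ Level.zero) (K : ℕ) : Set where
  field
    array        : SortedArray U
    k            : ℕ
    {{k-nonZero}} : NonZero k
  open SortedArray array public
  field
    k≤Kn         : k ℕ.≤ K ℕ.* n

  -- min (n, n Δ / k)
  load : ℚᵘ
  load = (+ n / 1) ℚᵘ.⊓ ((+ n / k) ℚᵘ.* Δ)

module _ {c ℓ₁ ℓ₂} (R : OrderedRing c ℓ₁ ℓ₂) {U : Pred ℤ Level.zero} (SD : Dictionary U) (K : ℕ) where
  open OrderedRing R using (Carrier)
  open Query using (key)
  private
    module Dₖ (P : Instance U K) = Binning SD (Instance.array P) (Instance.k P)

  BinnedBuildTime : (Instance U K → Carrier) → Set (c ⊔ ℓ₂)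
  BinnedBuildTime h = BigO R {I = Instance U K}
    (λ P → time (Dₖ.build P))
    h

  BinnedSearchTime : (Instance U K → Carrier) → Set (c ⊔ ℓ₂)
  BinnedSearchTime h = BigO R {I = Instance U K × Query U}
    (λ (P , q) → time (Dₖ.search P (value (Dₖ.build P)) (key q)))
    (λ (P , q) → h P)

{-# OPTIONS --safe #-}
-- Search: two elements of one bin are at most range / k apart, while c elements
-- span at least (c - 1) G-min and range ≤ (n - 1) G-max.  Hence
-- c - 1 ≤ (n - 1) Δ / k < n Δ / k, that is, c ≤ ⌈ n Δ / k ⌉; the strictness makes
-- up for the first bin being closed at both ends.
--
-- Build: the bins have n elements in total and g c ≤ g n for each of them, so
-- building all the copies of SD takes O(n g(n)).  The overhead O(n + k) is O(n),
-- and is absorbed because C g(1) ≥ 1 for the constant C of SD: building a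
-- singleton takes time at least 1.
module Submission where

import Algebra.Properties.CommutativeSemigroup as CommutativeSemigroupProperties
open import Data.Bool.Base using (true; false)
open import Data.Fin.Base as Fin using (Fin; zero; suc; fromℕ; toℕ; inject₁)
import Data.Fin.Properties as Fin
open import Data.Integer.Base as ℤ using (ℤ; +_; -[1+_]; +[1+_]; 0ℤ; ∣_∣)
open import Data.Integer.DivMod using (a≡a%n+[a/n]*n; n%d<d)
import Data.Integer.Properties as ℤ
import Data.Integer.Tactic.RingSolver as ℤSolver
open import Data.List.Base using (List; []; _∷_; _++_; length; tabulate)
open import Data.List.Extrema.Nat using (min≤xs; xs≤max)
open import Data.List.Membership.Propositional using (_∈_)
open import Data.List.Properties using (length-++; length-tabulate)
open import Data.List.Relation.Binary.Sublist.Propositional using (_⊆_; []; _∷_; _∷ʳ_; ⊆-refl; ⊆-reflexive; ⊆-trans)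
open import Data.List.Relation.Binary.Sublist.Propositional.Properties using (All-resp-⊆; ++⁺ˡ; ++⁺ʳ; length-mono-≤)
open import Data.List.Relation.Unary.All as All using (All; []; _∷_)
import Data.List.Relation.Unary.All.Properties as All
open import Data.List.Relation.Unary.AllPairs using (AllPairs; []; _∷_)
import Data.List.Relation.Unary.AllPairs.Properties as AllPairs
open import Data.List.Relation.Unary.Any using (here; there)
open import Data.Maybe.Base using (Maybe; just; nothing)
open import Data.Nat.Base as ℕ using (ℕ; zero; suc; NonZero; z≤n; s≤s)
import Data.Nat.Properties as ℕ
import Data.Nat.Tactic.RingSolver as ℕSolver
open import Data.Product.Base using (_×_; _,_; proj₁; proj₂; ∃-syntax)
open import Data.Rational.Unnormalised.Base as ℚᵘ using (ℚᵘ; _/_; ceiling)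
open import Data.Vec.Base using (lookup)
open import Function.Base using (_∘_)
open import Level using (Level)
open import Relation.Binary.Bundles using (Poset)
open import Relation.Binary.Core using (Rel; _Preserves_⟶_)
import Relation.Binary.Reasoning.PartialOrder as PosetReasoning
open import Relation.Binary.PropositionalEquality using (_≡_; _≢_; refl; sym; trans; cong; subst; subst₂; module ≡-Reasoning)
open import Relation.Nullary.Decidable using (yes; no)
open import Relation.Unary using (Pred)
open import Defs

-- Cancellation for the order on integers

+-cancelˡ-≤ : ∀ i {j k} → i ℤ.+ j ℤ.≤ i ℤ.+ k → j ℤ.≤ k
+-cancelˡ-≤ i i+j≤i+k = ℤ.≮⇒≥ (λ k<j → ℤ.<⇒≱ (ℤ.+-monoʳ-< i k<j) i+j≤i+k)

+-cancelʳ-< : ∀ k {i j} → i ℤ.+ k ℤ.< j ℤ.+ k → i ℤ.< j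
+-cancelʳ-< k i+k<j+k = ℤ.≰⇒> (λ j≤i → ℤ.<⇒≱ i+k<j+k (ℤ.+-monoˡ-≤ k j≤i))

-- Ceilings and bin indices

-- `ceiling` is the negated floor of the negated fraction, so the remainder of `- z` modulo `d` is
-- what `z` lacks to the next multiple of `d`.
ceiling-spec : ∀ z d .{{_ : NonZero d}} →
  ∃[ r ] r ℕ.< d × z ℤ.+ + r ≡ ceiling (z / d) ℤ.* + d
ceiling-spec z d@(suc _) = r , n%d<d (ℤ.- z) (+ d) , (begin
  z ℤ.+ + r                           ≡⟨ cong (ℤ._+ + r) (ℤ.neg-involutive z) ⟨
  ℤ.- (ℤ.- z) ℤ.+ + r                 ≡⟨ cong (λ y → ℤ.- y ℤ.+ + r) (a≡a%n+[a/n]*n (ℤ.- z) (+ d)) ⟩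
  ℤ.- (+ r ℤ.+ q ℤ.* + d) ℤ.+ + r     ≡⟨ rearrange (+ r) q (+ d) ⟩
  (ℤ.- q) ℤ.* + d                     ∎)
  where
  open ≡-Reasoning
  q = (ℤ.- z) ℤ./ + d
  r = (ℤ.- z) ℤ.% + d
  rearrange : ∀ r q d → ℤ.- (r ℤ.+ q ℤ.* d) ℤ.+ r ≡ (ℤ.- q) ℤ.* d
  rearrange = ℤSolver.solve-∀

≤-ceiling-* : ∀ z d .{{_ : NonZero d}} → z ℤ.≤ ceiling (z / d) ℤ.* + d
≤-ceiling-* z d = let r , _ , eq = ceiling-spec z d in
  ℤ.≤-trans (ℤ.i≤i+j z (+ r)) (ℤ.≤-reflexive eq)

ceiling-*-< : ∀ z d .{{_ : NonZero d}} → ceiling (z / d) ℤ.* + d ℤ.< z ℤ.+ + d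
ceiling-*-< z d = let r , r<d , eq = ceiling-spec z d in
  subst (ℤ._< z ℤ.+ + d) eq (ℤ.+-monoʳ-< z (ℤ.+<+ r<d))

-- Compare `m < p / d ≤ ⌈ p / d ⌉`. The absolute value is harmless: a ceiling above the natural
-- number `m` is non-negative.
<-ceiling : ∀ m {p} d .{{_ : NonZero d}} → m ℕ.* d ℕ.< p → m ℕ.< ∣ ceiling (+ p / d) ∣
<-ceiling m {p} d md<p = ℤ.drop‿+<+ (subst (+ m ℤ.<_) (sym (ℤ.0≤i⇒+∣i∣≡i 0≤c)) m<c)
  where
  m<c : + m ℤ.< ceiling (+ p / d)
  m<c = ℤ.*-cancelʳ-<-nonNeg (+ d)
    (ℤ.<-≤-trans (subst (ℤ._< + p) (ℤ.pos-* m d) (ℤ.+<+ md<p)) (≤-ceiling-* (+ p) d))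
  0≤c : 0ℤ ℤ.≤ ceiling (+ p / d)
  0≤c = ℤ.≤-trans (ℤ.+≤+ z≤n) (ℤ.<⇒≤ m<c)

-- `_⊓_` returns one of its arguments by a Boolean test, so no reasoning about the order of
-- rationals is involved.
⊓-elim : ∀ {ℓ} (P : ℚᵘ → Set ℓ) p q → P p → P q → P (p ℚᵘ.⊓ q)
⊓-elim P p@record{} q@record{} Pp Pq with p ℚᵘ.≤ᵇ q
... | true  = Pp
... | false = Pq

-- The hypotheses are `m < n` and `m < (n / k) (G / g)` with denominators cleared. With `m` one less
-- than the size of a bin, this bounds the size by the rounded load.
<-ceiling-load : ∀ m n k .{{_ : NonZero k}} G g .{{_ : NonZero g}} →
  m ℕ.< n → m ℕ.* (k ℕ.* g) ℕ.< n ℕ.* G →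
  m ℕ.< ∣ ceiling ((+ n / 1) ℚᵘ.⊓ ((+ n / k) ℚᵘ.* (+ G / g))) ∣
<-ceiling-load m n k@(suc _) G g@(suc _) m<n mkg<nG =
  ⊓-elim (λ q → m ℕ.< ∣ ceiling q ∣) (+ n / 1) ((+ n / k) ℚᵘ.* (+ G / g))
    (<-ceiling m 1 (subst (ℕ._< n) (sym (ℕ.*-identityʳ m)) m<n))
    (subst (λ z → m ℕ.< ∣ ceiling (z / (k ℕ.* g)) ∣) (ℤ.pos-* n G) (<-ceiling m (k ℕ.* g) mkg<nG))

toℕ-clamp-suc : ∀ k .{{_ : NonZero k}} c → c ℕ.< k → toℕ (clamp k +[1+ c ]) ≡ c
toℕ-clamp-suc (suc k) c (s≤s c≤k) = trans (Fin.toℕ-fromℕ< _)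
  (trans (cong (ℕ._⊓ k) (ℕ.⊔-identityʳ c)) (ℕ.m≤n⇒m⊓n≡m c≤k))

toℕ-clamp-nonPos : ∀ k .{{_ : NonZero k}} {c} → c ℤ.≤ 0ℤ → toℕ (clamp k c) ≡ 0
toℕ-clamp-nonPos (suc k) {+ 0}       _ = refl
toℕ-clamp-nonPos (suc k) { -[1+ _ ]} _ = refl
toℕ-clamp-nonPos (suc k) {+[1+ _ ]}  (ℤ.+≤+ ())

-- A ceiling `c + 1` gives `c r < z ≤ (c + 1) r`, and `z ≤ k r` keeps `c` below `k`, so nothing is
-- cut off at the top. A ceiling of 0 leaves only `z = 0`, clamped to index 0; this case makes the
-- lower bound weak.
clamp-bounds : ∀ k .{{_ : NonZero k}} r .{{_ : NonZero r}} z →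
  0ℤ ℤ.≤ z → z ℤ.≤ + k ℤ.* + r →
  let j = toℕ (clamp k (ceiling (z / r))) in
  + j ℤ.* + r ℤ.≤ z × z ℤ.≤ + j ℤ.* + r ℤ.+ + r
clamp-bounds k r z 0≤z z≤kr with ceiling (z / r) | ≤-ceiling-* z r | ceiling-*-< z r
... | +[1+ c ] | z≤cr | cr<z+r =
  subst (λ j → + j ℤ.* + r ℤ.≤ z × z ℤ.≤ + j ℤ.* + r ℤ.+ + r) (sym (toℕ-clamp-suc k c c<k))
    (ℤ.<⇒≤ c*r<z , subst (z ℤ.≤_) (suc-* (+ c) (+ r)) z≤cr)
  where
  suc-* : ∀ c r → (+ 1 ℤ.+ c) ℤ.* r ≡ c ℤ.* r ℤ.+ r
  suc-* = ℤSolver.solve-∀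
  c*r<z : + c ℤ.* + r ℤ.< z
  c*r<z = +-cancelʳ-< (+ r) (subst (ℤ._< z ℤ.+ + r) (suc-* (+ c) (+ r)) cr<z+r)
  c<k : c ℕ.< k
  c<k = ℤ.drop‿+<+ (ℤ.*-cancelʳ-<-nonNeg (+ r) (ℤ.<-≤-trans c*r<z z≤kr))
... | + 0      | z≤cr | _ rewrite toℕ-clamp-nonPos k {+ 0} ℤ.≤-refl =
  0≤z , ℤ.≤-trans z≤cr (ℤ.+≤+ z≤n)
-- A negative ceiling cannot occur with `0 ≤ z`, but the bounds of bin 0 follow here just as for
-- ceiling 0.
... | -[1+ c ] | z≤cr | _ rewrite toℕ-clamp-nonPos k { -[1+ c ]} ℤ.-≤+ =
  0≤z , ℤ.≤-trans z≤cr (ℤ.≤-trans (ℤ.*-monoʳ-≤-nonNeg (+ r) (ℤ.-≤+ {c} {0})) (ℤ.+≤+ z≤n))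

-- Gaps

AllPairs-resp-⊆ : ∀ {a ℓ} {X : Set a} {R : Rel X ℓ} {xs ys} →
  xs ⊆ ys → AllPairs R ys → AllPairs R xs
AllPairs-resp-⊆ []         []       = []
AllPairs-resp-⊆ (_ ∷ʳ p) (_ ∷ rs) = AllPairs-resp-⊆ p rs
AllPairs-resp-⊆ (refl ∷ p) (r ∷ rs) = All-resp-⊆ p r ∷ AllPairs-resp-⊆ p rs

-- The distances of neighbours add up, and the witness is the last element. It comes with its
-- membership so that properties of the whole list can be looked up for it.
separated⇒span : ∀ d {a as} → AllPairs (λ x y → x ℤ.+ + d ℤ.≤ y) (a ∷ as) →
  ∃[ y ] y ∈ a ∷ as × a ℤ.+ + (length as ℕ.* d) ℤ.≤ y
separated⇒span d {a} {[]}     _                    = a , here refl , ℤ.≤-reflexive (ℤ.+-identityʳ a)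
separated⇒span d {a} {b ∷ bs} ((a+d≤b ∷ _) ∷ sep) =
  let y , y∈ , b+≤y = separated⇒span d sep in y , there y∈ , (begin
    a ℤ.+ (+ d ℤ.+ + (length bs ℕ.* d))  ≡⟨ ℤ.+-assoc a (+ d) _ ⟨
    a ℤ.+ + d ℤ.+ + (length bs ℕ.* d)    ≤⟨ ℤ.+-monoˡ-≤ _ a+d≤b ⟩
    b ℤ.+ + (length bs ℕ.* d)            ≤⟨ b+≤y ⟩
    y                                    ∎)
  where open ℤ.≤-Reasoning

-- Telescoping; the induction peels off the first step and shifts the array. It serves to bound the
-- range by `n - 1` maximal gaps.
bounded-steps : ∀ G m (B : Fin (suc m) → ℤ) →
  (∀ i → B (suc i) ℤ.≤ B (inject₁ i) ℤ.+ + G) → B (fromℕ m) ℤ.≤ B zero ℤ.+ + (m ℕ.* G)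
bounded-steps G zero    B _     = ℤ.≤-reflexive (sym (ℤ.+-identityʳ (B zero)))
bounded-steps G (suc m) B steps = begin
  B (suc (fromℕ m))                     ≤⟨ bounded-steps G m (B ∘ suc) (steps ∘ suc) ⟩
  B (suc zero) ℤ.+ + (m ℕ.* G)          ≤⟨ ℤ.+-monoˡ-≤ (+ (m ℕ.* G)) (steps zero) ⟩
  B zero ℤ.+ + G ℤ.+ + (m ℕ.* G)        ≡⟨ ℤ.+-assoc (B zero) (+ G) _ ⟩
  B zero ℤ.+ + (G ℕ.+ m ℕ.* G)          ∎
  where open ℤ.≤-Reasoning

≤⇒distance : ∀ {x y} → x ℤ.≤ y → + ∣ y ℤ.- x ∣ ≡ y ℤ.- x
≤⇒distance x≤y = ℤ.0≤i⇒+∣i∣≡i (ℤ.i≤j⇒0≤j-i x≤y)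

≤⇒+distance : ∀ {x y} → x ℤ.≤ y → x ℤ.+ + ∣ y ℤ.- x ∣ ≡ y
≤⇒+distance {x} {y} x≤y = trans (cong (λ d → x ℤ.+ d) (≤⇒distance x≤y)) (x+[y-x] x y)
  where
  x+[y-x] : ∀ x y → x ℤ.+ (y ℤ.- x) ≡ y
  x+[y-x] = ℤSolver.solve-∀

module SortedArrayProperties {U : Pred ℤ Level.zero} (𝐀 : SortedArray U) where
  open SortedArray 𝐀

  A-mono : A Preserves Fin._≤_ ⟶ ℤ._≤_
  A-mono {i} {j} i≤j with toℕ i ℕ.≟ toℕ j
  ... | yes i≡j = ℤ.≤-reflexive (cong A (Fin.toℕ-injective i≡j))
  ... | no  i≢j = ℤ.<⇒≤ (sorted (ℕ.≤∧≢⇒< i≤j i≢j))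

  A-gap : ∀ i → A (inject₁ i) ℤ.+ + gap i ≡ A (suc i)
  A-gap i = ≤⇒+distance (A-mono (ℕ.≤-trans (ℕ.≤-reflexive (Fin.toℕ-inject₁ i)) (ℕ.n≤1+n _)))

  G-min≤gap : ∀ i → G-min ℕ.≤ gap i
  G-min≤gap = All.tabulate⁻ {f = gap} (min≤xs (gap zero) (tabulate gap))

  gap≤G-max : ∀ i → gap i ℕ.≤ G-max
  gap≤G-max = All.tabulate⁻ {f = gap} (xs≤max (gap zero) (tabulate gap))

  -- Between `A i` and a later entry lies at least the gap just before the later one, and the entry
  -- preceding that gap is still at least `A i`.
  A-separated : AllPairs (λ x y → x ℤ.+ + G-min ℤ.≤ y) (tabulate A)
  A-separated = AllPairs.tabulate⁺-< separated
    where
    separated : ∀ {i j} → i Fin.< j → A i ℤ.+ + G-min ℤ.≤ A j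
    separated {i} {suc j} (s≤s i≤j) = begin
      A i ℤ.+ + G-min            ≤⟨ ℤ.+-mono-≤ (A-mono (ℕ.≤-trans i≤j (ℕ.≤-reflexive (sym (Fin.toℕ-inject₁ j)))))
                                     (ℤ.+≤+ (G-min≤gap j)) ⟩
      A (inject₁ j) ℤ.+ + gap j  ≡⟨ A-gap j ⟩
      A (suc j)                  ∎
      where open ℤ.≤-Reasoning

  A₁≤Aₙ : A₁ ℤ.≤ Aₙ
  A₁≤Aₙ = A-mono z≤n

  range≤ : range ℕ.≤ suc n-2 ℕ.* G-max
  range≤ = ℤ.drop‿+≤+ (+-cancelˡ-≤ A₁ (begin
    A₁ ℤ.+ + range                    ≡⟨ ≤⇒+distance A₁≤Aₙ ⟩
    Aₙ                                ≤⟨ bounded-steps G-max (suc n-2) A steps ⟩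
    A₁ ℤ.+ + (suc n-2 ℕ.* G-max)      ∎))
    where
    open ℤ.≤-Reasoning
    steps : ∀ i → A (suc i) ℤ.≤ A (inject₁ i) ℤ.+ + G-max
    steps i = begin
      A (suc i)                  ≡⟨ A-gap i ⟨
      A (inject₁ i) ℤ.+ + gap i  ≤⟨ ℤ.+-monoʳ-≤ (A (inject₁ i)) (ℤ.+≤+ (gap≤G-max i)) ⟩
      A (inject₁ i) ℤ.+ + G-max  ∎

  G-max>0 : 0 ℕ.< G-max
  G-max>0 = ℕ.<-≤-trans (ℕ.>-nonZero⁻¹ G-min)
    (ℕ.≤-trans (G-min≤gap zero) (gap≤G-max zero))

  elements-sorted : StrictlySorted (tabulate A)
  elements-sorted = AllPairs.tabulate⁺-< sorted

  elements-inU : All U (tabulate A)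
  elements-inU = All.tabulate⁺ inU

  subset : ∀ {xs} → xs ≢ [] → xs ⊆ tabulate A → NonEmptySet U
  subset {xs} xs≢[] xs⊆A = record
    { elements = xs
    ; nonEmpty = xs≢[]
    ; sorted   = AllPairs-resp-⊆ xs⊆A elements-sorted
    ; inU      = All-resp-⊆ xs⊆A elements-inU
    }

  -- The instance on which running times of at least 1 force the assumed bounds for `SD` to be at
  -- least 1.
  singleton : NonEmptySet U
  singleton = record
    { elements = A₁ ∷ []
    ; nonEmpty = λ ()
    ; sorted   = [] ∷ []
    ; inU      = inU zero ∷ []
    }

  size≤n : ∀ {xs} → xs ⊆ tabulate A → length xs ℕ.≤ n
  size≤n {xs} xs⊆A = subst (length xs ℕ.≤_) (length-tabulate A) (length-mono-≤ xs⊆A)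

-- Bins

module BinningProperties {U : Pred ℤ Level.zero} (SD : Dictionary U)
                         (𝐀 : SortedArray U) (k : ℕ) .{{_ : NonZero k}} where
  open SortedArray 𝐀
  open SortedArrayProperties 𝐀
  open Binning SD 𝐀 k
  private module SD = Dictionary SD

  scaled-bounds : ∀ {x} → A₁ ℤ.≤ x → x ℤ.≤ Aₙ →
    0ℤ ℤ.≤ (x ℤ.- A₁) ℤ.* + k × (x ℤ.- A₁) ℤ.* + k ℤ.≤ + k ℤ.* + range
  scaled-bounds {x} A₁≤x x≤Aₙ =
    ℤ.*-monoʳ-≤-nonNeg (+ k) (ℤ.i≤j⇒0≤j-i A₁≤x) , (begin
      (x ℤ.- A₁) ℤ.* + k      ≤⟨ ℤ.*-monoʳ-≤-nonNeg (+ k) (ℤ.+-monoˡ-≤ (ℤ.- A₁) x≤Aₙ) ⟩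
      (Aₙ ℤ.- A₁) ℤ.* + k     ≡⟨ cong (ℤ._* + k) (≤⇒distance A₁≤Aₙ) ⟨
      + range ℤ.* + k         ≡⟨ ℤ.*-comm (+ range) (+ k) ⟩
      + k ℤ.* + range         ∎)
    where open ℤ.≤-Reasoning

  -- The interval of bin `j`, multiplied by `k` to avoid fractions, and closed at both ends so that
  -- the first bin contains `A₁`.
  InBin : ℕ → ℤ → Set
  InBin j x = + j ℤ.* + range ℤ.≤ (x ℤ.- A₁) ℤ.* + k
            × (x ℤ.- A₁) ℤ.* + k ℤ.≤ + j ℤ.* + range ℤ.+ + range

  bin⇒InBin : All (λ x → InBin (toℕ (bin x)) x) (tabulate A)
  bin⇒InBin = All.tabulate⁺ {f = A} λ i →
    let 0≤z , z≤kr = scaled-bounds (A-mono z≤n) (A-mono (Fin.≤fromℕ i)) in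
    clamp-bounds k range ((A i ℤ.- A₁) ℤ.* + k) 0≤z z≤kr

  -- Scaled by `k`, a bin is an interval of length `range`, which bounds the scaled distance of its
  -- points.
  sameBin⇒distance : ∀ {j x y} d → InBin j x → InBin j y → x ℤ.+ + d ℤ.≤ y → d ℕ.* k ℕ.≤ range
  sameBin⇒distance {j} {x} {y} d (jr≤x , _) (_ , y≤jr+r) x+d≤y =
    ℤ.drop‿+≤+ (+-cancelˡ-≤ (+ j ℤ.* + range) (begin
      + j ℤ.* + range ℤ.+ + (d ℕ.* k)             ≤⟨ ℤ.+-monoˡ-≤ (+ (d ℕ.* k)) jr≤x ⟩
      (x ℤ.- A₁) ℤ.* + k ℤ.+ + (d ℕ.* k)          ≡⟨ cong (λ z → (x ℤ.- A₁) ℤ.* + k ℤ.+ z) (ℤ.pos-* d k) ⟩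
      (x ℤ.- A₁) ℤ.* + k ℤ.+ + d ℤ.* + k          ≡⟨ rearrange x A₁ (+ d) (+ k) ⟩
      (x ℤ.+ + d ℤ.- A₁) ℤ.* + k                  ≤⟨ ℤ.*-monoʳ-≤-nonNeg (+ k) (ℤ.+-monoˡ-≤ (ℤ.- A₁) x+d≤y) ⟩
      (y ℤ.- A₁) ℤ.* + k                          ≤⟨ y≤jr+r ⟩
      + j ℤ.* + range ℤ.+ + range                 ∎))
    where
    open ℤ.≤-Reasoning
    rearrange : ∀ x a d k → (x ℤ.- a) ℤ.* k ℤ.+ d ℤ.* k ≡ (x ℤ.+ d ℤ.- a) ℤ.* k
    rearrange = ℤSolver.solve-∀

  -- `length xs` is one less than the number of elements, because `c` elements enclose only `c - 1`
  -- gaps.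
  bin-size : ∀ {j x xs} → x ∷ xs ⊆ tabulate A → All (λ y → toℕ (bin y) ≡ j) (x ∷ xs) →
    length xs ℕ.* (k ℕ.* G-min) ℕ.< n ℕ.* G-max
  bin-size {j} {x} {xs} xs⊆A bins = begin-strict
    length xs ℕ.* (k ℕ.* G-min)   ≡⟨ rearrange (length xs) k G-min ⟩
    length xs ℕ.* G-min ℕ.* k     ≤⟨ spanned (separated⇒span G-min (AllPairs-resp-⊆ xs⊆A A-separated)) ⟩
    range                         ≤⟨ range≤ ⟩
    -- `n` entries have `n - 1` gaps; the one extra positive `G-max` makes the inequality strict.
    suc n-2 ℕ.* G-max             <⟨ ℕ.m<n+m (suc n-2 ℕ.* G-max) G-max>0 ⟩
    n ℕ.* G-max                   ∎
    where
    open ℕ.≤-Reasoning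
    rearrange : ∀ m k g → m ℕ.* (k ℕ.* g) ≡ m ℕ.* g ℕ.* k
    rearrange = ℕSolver.solve-∀
    inBin : All (InBin j) (x ∷ xs)
    inBin = All.zipWith (λ {y} (b , p) → subst (λ i → InBin i y) b p) (bins , All-resp-⊆ xs⊆A bin⇒InBin)
    spanned : ∃[ y ] y ∈ x ∷ xs × x ℤ.+ + (length xs ℕ.* G-min) ℤ.≤ y →
      length xs ℕ.* G-min ℕ.* k ℕ.≤ range
    spanned (y , y∈ , x+≤y) =
      sameBin⇒distance {j} {x} {y} (length xs ℕ.* G-min) (All.head inBin) (All.lookup inBin y∈) x+≤y

  -- Cutting off one bin: contents and cost

  taken left : ℕ → List ℤ → List ℤ
  taken j as = proj₁ (value (takeBin j as))
  left  j as = proj₂ (value (takeBin j as))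

  taken++left : ∀ j as → taken j as ++ left j as ≡ as
  taken++left j []       = refl
  taken++left j (a ∷ as) with toℕ (bin a) ℕ.≟ j
  ... | yes _ = cong (a ∷_) (taken++left j as)
  ... | no  _ = refl

  taken-bin : ∀ j as → All (λ a → toℕ (bin a) ≡ j) (taken j as)
  taken-bin j []       = []
  taken-bin j (a ∷ as) with toℕ (bin a) ℕ.≟ j
  ... | yes b = b ∷ taken-bin j as
  ... | no  _ = []

  -- A taken element costs 9 for its bin index, 1 for the comparison and 1 for the result. The
  -- additive 11 pays for the element that ends the prefix, or for the end of the list.
  takeBin-time : ∀ j as → time (takeBin j as) ℕ.≤ 11 ℕ.* length (taken j as) ℕ.+ 11
  takeBin-time j []       = s≤s z≤n
  takeBin-time j (a ∷ as) with toℕ (bin a) ℕ.≟ j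
  ... | yes _ = begin
    10 ℕ.+ (time (takeBin j as) ℕ.+ 1)                  ≤⟨ ℕ.+-monoʳ-≤ 10 (ℕ.+-monoˡ-≤ 1 (takeBin-time j as)) ⟩
    10 ℕ.+ (11 ℕ.* length (taken j as) ℕ.+ 11 ℕ.+ 1)    ≡⟨ rearrange (length (taken j as)) ⟩
    11 ℕ.* suc (length (taken j as)) ℕ.+ 11             ∎
    where
    open ℕ.≤-Reasoning
    rearrange : ∀ m → 10 ℕ.+ (11 ℕ.* m ℕ.+ 11 ℕ.+ 1) ≡ 11 ℕ.* (1 ℕ.+ m) ℕ.+ 11
    rearrange = ℕSolver.solve-∀
  ... | no  _ = ℕ.≤-refl

  taken-⊆ : ∀ j as → taken j as ⊆ as
  taken-⊆ j as = ⊆-trans (++⁺ʳ (left j as) ⊆-refl) (⊆-reflexive (taken++left j as))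

  left-⊆ : ∀ j as → left j as ⊆ as
  left-⊆ j as = ⊆-trans (++⁺ˡ (taken j as) ⊆-refl) (⊆-reflexive (taken++left j as))

  length-taken-left : ∀ j as → length (taken j as) ℕ.+ length (left j as) ≡ length as
  length-taken-left j as = trans (sym (length-++ (taken j as))) (cong length (taken++left j as))

  -- The search bound of `SD` speaks of structures returned by `build`, so a non-null entry is
  -- tracked together with the list that it was built from.
  data BinOf (as : List ℤ) (j : ℕ) : Maybe SD.Structure → Set where
    empty : BinOf as j nothing
    built : ∀ {x xs} → x ∷ xs ⊆ as → All (λ y → toℕ (bin y) ≡ j) (x ∷ xs) →
            BinOf as j (just (value (SD.build (x ∷ xs))))

  BinOf-resp-⊆ : ∀ {as bs j s} → as ⊆ bs → BinOf as j s → BinOf bs j s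
  BinOf-resp-⊆ as⊆bs empty          = empty
  BinOf-resp-⊆ as⊆bs (built p bins) = built (⊆-trans p as⊆bs) bins

  buildBin-BinOf : ∀ {as j xs} → xs ⊆ as → All (λ y → toℕ (bin y) ≡ j) xs →
    BinOf as j (value (buildBin xs))
  buildBin-BinOf {xs = []}    _ _    = empty
  buildBin-BinOf {xs = _ ∷ _} p bins = built p bins

  -- Induction over the bins still to be built: later bins are cut from what the earlier ones leave,
  -- which is again a sublist of `as`.
  lookup-buildBins : ∀ r j as (i : Fin r) →
    BinOf as (j ℕ.+ toℕ i) (lookup (value (buildBins r j as)) i)
  lookup-buildBins (suc r) j as zero    =
    subst (λ i → BinOf as i (value (buildBin (taken j as)))) (sym (ℕ.+-identityʳ j))
      (buildBin-BinOf (taken-⊆ j as) (taken-bin j as))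
  lookup-buildBins (suc r) j as (suc i) =
    subst (λ i′ → BinOf as i′ (lookup (value (buildBins r (suc j) (left j as))) i)) (sym (ℕ.+-suc j (toℕ i)))
      (BinOf-resp-⊆ (left-⊆ j as) (lookup-buildBins r (suc j) (left j as) i))

-- Ordered rings

module OrderedRingProperties {c ℓ₁ ℓ₂} (R : OrderedRing c ℓ₁ ℓ₂) where
  open OrderedRing R renaming (sym to ≈-sym)

  poset : Poset c ℓ₁ ℓ₂
  poset = record { isPartialOrder = isPartialOrder }

  open Poset poset public using () renaming (refl to ≤-refl; trans to ≤-trans; reflexive to ≤-reflexive)
  open PosetReasoning poset

  +-monoʳ-≤ : ∀ z {x y} → x ≤ y → z + x ≤ z + y
  +-monoʳ-≤ z {x} {y} x≤y = begin
    z + x  ≈⟨ +-comm z x ⟩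
    x + z  ≤⟨ +-monoˡ-≤ z x≤y ⟩
    y + z  ≈⟨ +-comm y z ⟩
    z + y  ∎

  +-mono-≤ : ∀ {x y u v} → x ≤ y → u ≤ v → x + u ≤ y + v
  +-mono-≤ x≤y u≤v = ≤-trans (+-monoˡ-≤ _ x≤y) (+-monoʳ-≤ _ u≤v)

  -- The axioms only speak of products of non-negative elements, hence the detour through
  -- `z * (y - x)`.
  *-monoʳ-≤-nonNeg : ∀ {z x y} → 0# ≤ z → x ≤ y → z * x ≤ z * y
  *-monoʳ-≤-nonNeg {z} {x} {y} 0≤z x≤y = begin
    z * x                      ≈⟨ +-identityˡ (z * x) ⟨
    0# + z * x                 ≤⟨ +-monoˡ-≤ (z * x) (*-nonNeg 0≤z 0≤y-x) ⟩
    z * (y + - x) + z * x      ≈⟨ distribˡ z (y + - x) x ⟨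
    z * (y + - x + x)          ≈⟨ *-congˡ (+-assoc y (- x) x) ⟩
    z * (y + (- x + x))        ≈⟨ *-congˡ (+-congˡ (-‿inverseˡ x)) ⟩
    z * (y + 0#)               ≈⟨ *-congˡ (+-identityʳ y) ⟩
    z * y                      ∎
    where
    0≤y-x : 0# ≤ y + - x
    0≤y-x = begin
      0#        ≈⟨ -‿inverseʳ x ⟨
      x + - x   ≤⟨ +-monoˡ-≤ (- x) x≤y ⟩
      y + - x   ∎

  ι-nonNeg : ∀ m → 0# ≤ ι m
  ι-nonNeg zero    = ≤-refl
  ι-nonNeg (suc m) = begin
    0#        ≈⟨ +-identityˡ 0# ⟨
    0# + 0#   ≤⟨ +-mono-≤ 0≤1 (ι-nonNeg m) ⟩
    1# + ι m  ∎

  ι-mono-≤ : ∀ {m n} → m ℕ.≤ n → ι m ≤ ι n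
  ι-mono-≤ {n = n} z≤n = ι-nonNeg n
  ι-mono-≤ (s≤s m≤n)   = +-monoʳ-≤ 1# (ι-mono-≤ m≤n)

  ι-+ : ∀ m n → ι (m ℕ.+ n) ≈ ι m + ι n
  ι-+ zero    n = ≈-sym (+-identityˡ (ι n))
  ι-+ (suc m) n = begin-equality
    1# + ι (m ℕ.+ n)    ≈⟨ +-congˡ (ι-+ m n) ⟩
    1# + (ι m + ι n)    ≈⟨ +-assoc 1# (ι m) (ι n) ⟨
    1# + ι m + ι n      ∎

  ι-* : ∀ m n → ι (m ℕ.* n) ≈ ι m * ι n
  ι-* zero    n = ≈-sym (zeroˡ (ι n))
  ι-* (suc m) n = begin-equality
    ι (n ℕ.+ m ℕ.* n)       ≈⟨ ι-+ n (m ℕ.* n) ⟩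
    ι n + ι (m ℕ.* n)       ≈⟨ +-cong (*-identityˡ (ι n)) (≈-sym (ι-* m n)) ⟨
    1# * ι n + ι m * ι n    ≈⟨ distribʳ (ι n) 1# (ι m) ⟨
    (1# + ι m) * ι n        ∎

  1≤ι : ∀ {m} → 1 ℕ.≤ m → 1# ≤ ι m
  1≤ι {m} 1≤m = begin
    1#        ≈⟨ +-identityʳ 1# ⟨
    1# + 0#   ≤⟨ ι-mono-≤ 1≤m ⟩
    ι m       ∎

  -- Turns an additive constant into a factor, since `a ≤ a * x` once `1 ≤ x`. Both the build
  -- overhead and the constant part of a query are treated this way.
  absorb : ∀ {a x y} → 0# ≤ a → 1# ≤ x → y ≤ x → a + y ≤ (a + 1#) * x
  absorb {a} {x} {y} 0≤a 1≤x y≤x = begin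
    a + y              ≈⟨ +-congʳ (*-identityʳ a) ⟨
    a * 1# + y         ≤⟨ +-mono-≤ (*-monoʳ-≤-nonNeg 0≤a 1≤x) y≤x ⟩
    a * x + x          ≈⟨ +-congˡ (*-identityˡ x) ⟨
    a * x + 1# * x     ≈⟨ distribʳ x a 1# ⟨
    (a + 1#) * x       ∎

  ι+1-nonNeg : ∀ m → 0# ≤ ι m + 1#
  ι+1-nonNeg m = begin
    0#          ≤⟨ ι-nonNeg (suc m) ⟩
    1# + ι m    ≈⟨ +-comm 1# (ι m) ⟩
    ι m + 1#    ∎

-- Running times

module BinnedTimes {c ℓ₁ ℓ₂} (R : OrderedRing c ℓ₁ ℓ₂) {U : Pred ℤ Level.zero} (SD : Dictionary U) (K : ℕ) where
  open OrderedRing R hiding (refl; sym; trans)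
  open OrderedRingProperties R
  open PosetReasoning poset
  open CommutativeSemigroupProperties +-commutativeSemigroup using () renaming (interchange to +-interchange)
  open CommutativeSemigroupProperties *-commutativeSemigroup using () renaming (x∙yz≈y∙xz to *-swap)
  private module SD = Dictionary SD

  -- Construction time of the binned dictionary

  module Building (g : ℕ → Carrier) (g-mono : NonDecreasing R g) (C : Carrier) (0≤C : 0# ≤ C)
                  (build≤ : ∀ (S : NonEmptySet U) → ι (time (SD.build (NonEmptySet.elements S))) ≤
                                  C * (ι (NonEmptySet.size S) * g (NonEmptySet.size S)))
                  (P : Instance U K) where
    open Instance P
    open SortedArrayProperties array
    open BinningProperties SD array k
    open Binning SD array k

    1≤Cg : 1# ≤ C * g n
    1≤Cg = begin
      1#                            ≤⟨ 1≤ι (SD.build-time _) ⟩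
      ι (time (SD.build (A₁ ∷ []))) ≤⟨ build≤ singleton ⟩
      C * ((1# + 0#) * g 1)         ≈⟨ *-congˡ (*-congʳ (+-identityʳ 1#)) ⟩
      C * (1# * g 1)                ≈⟨ *-congˡ (*-identityˡ (g 1)) ⟩
      C * g 1                       ≤⟨ *-monoʳ-≤-nonNeg 0≤C (g-mono (s≤s z≤n)) ⟩
      C * g n                       ∎

    infix 4 _≼_⊹_

    -- C * g n bounds the cost per element of building SD on any bin.
    record _≼_⊹_ (t u m : ℕ) : Set ℓ₂ where
      constructor ≼⟨_⟩
      field bound : ι t ≤ ι u + ι m * (C * g n)

    open _≼_⊹_

    ≤⇒≼ : ∀ {t u} → t ℕ.≤ u → t ≼ u ⊹ 0
    ≤⇒≼ {t} {u} t≤u = ≼⟨ begin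
      ι t                       ≤⟨ ι-mono-≤ t≤u ⟩
      ι u                       ≈⟨ +-identityʳ (ι u) ⟨
      ι u + 0#                  ≈⟨ +-congˡ (zeroˡ (C * g n)) ⟨
      ι u + 0# * (C * g n)      ∎ ⟩

    ≼-+ : ∀ {t₁ u₁ m₁ t₂ u₂ m₂} → t₁ ≼ u₁ ⊹ m₁ → t₂ ≼ u₂ ⊹ m₂ → t₁ ℕ.+ t₂ ≼ u₁ ℕ.+ u₂ ⊹ m₁ ℕ.+ m₂
    ≼-+ {t₁} {u₁} {m₁} {t₂} {u₂} {m₂} p q = ≼⟨ begin
      ι (t₁ ℕ.+ t₂)                              ≈⟨ ι-+ t₁ t₂ ⟩
      ι t₁ + ι t₂                                ≤⟨ +-mono-≤ (bound p) (bound q) ⟩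
      (ι u₁ + ι m₁ * G) + (ι u₂ + ι m₂ * G)      ≈⟨ +-interchange (ι u₁) (ι m₁ * G) (ι u₂) (ι m₂ * G) ⟩
      (ι u₁ + ι u₂) + (ι m₁ * G + ι m₂ * G)      ≈⟨ +-cong (ι-+ u₁ u₂) (distribʳ G (ι m₁) (ι m₂)) ⟨
      ι (u₁ ℕ.+ u₂) + (ι m₁ + ι m₂) * G          ≈⟨ +-congˡ (*-congʳ (ι-+ m₁ m₂)) ⟨
      ι (u₁ ℕ.+ u₂) + ι (m₁ ℕ.+ m₂) * G          ∎ ⟩
      where G = C * g n

    -- Monotonicity replaces `g (length xs)` by `g n`; the charge is then linear in the size of the
    -- bin and adds up over the bins.
    build-≼ : ∀ {xs} → xs ≢ [] → xs ⊆ tabulate A → time (SD.build xs) ≼ 0 ⊹ length xs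
    build-≼ {xs} xs≢[] xs⊆A = ≼⟨ begin
      ι (time (SD.build xs))                 ≤⟨ build≤ (subset xs≢[] xs⊆A) ⟩
      C * (ι (length xs) * g (length xs))    ≈⟨ *-swap C (ι (length xs)) _ ⟩
      ι (length xs) * (C * g (length xs))    ≤⟨ *-monoʳ-≤-nonNeg (ι-nonNeg (length xs))
                                                  (*-monoʳ-≤-nonNeg 0≤C (g-mono (size≤n xs⊆A))) ⟩
      ι (length xs) * (C * g n)              ≈⟨ +-identityˡ _ ⟨
      0# + ι (length xs) * (C * g n)         ∎ ⟩

    buildBin-≼ : ∀ {xs} → xs ⊆ tabulate A → time (buildBin xs) ≼ 1 ⊹ length xs
    buildBin-≼ {[]}         _    = ≤⇒≼ ℕ.≤-refl
    buildBin-≼ {xs@(_ ∷ _)} xs⊆A =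
      subst (time (buildBin xs) ≼ 1 ⊹_) (ℕ.+-identityʳ (length xs))
        (≼-+ (build-≼ (λ ()) xs⊆A) (≤⇒≼ ℕ.≤-refl))

    -- Each bin costs 13 besides its elements: 11 to end its prefix, 1 for its pointer and 1 for
    -- writing the entry. The final 1 is for the empty array.
    buildBins-≼ : ∀ r j {as} → as ⊆ tabulate A →
      time (buildBins r j as) ≼ 11 ℕ.* length as ℕ.+ 13 ℕ.* r ℕ.+ 1 ⊹ length as
    -- Elements of `as` only enlarge the budget here, because `0 ≤ 1 ≤ C * g n`.
    buildBins-≼ zero    j {as} as⊆A = ≼⟨ begin
      ι 1                                 ≈⟨ +-identityʳ (ι 1) ⟨
      ι 1 + 0#                            ≤⟨ +-mono-≤ (ι-mono-≤ (ℕ.m≤n+m 1 (11 ℕ.* length as ℕ.+ 13 ℕ.* 0)))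
                                                      (*-nonNeg (ι-nonNeg (length as)) (≤-trans 0≤1 1≤Cg)) ⟩
      ι (11 ℕ.* length as ℕ.+ 13 ℕ.* 0 ℕ.+ 1) + ι (length as) * (C * g n) ∎ ⟩
    buildBins-≼ (suc r) j {as} as⊆A =
      subst₂ (time (buildBins (suc r) j as) ≼_⊹_)
        (trans (rearrange h l r) (cong (λ m → 11 ℕ.* m ℕ.+ 13 ℕ.* suc r ℕ.+ 1) (length-taken-left j as)))
        (trans (cong (h ℕ.+_) (ℕ.+-identityʳ l)) (length-taken-left j as))
        (≼-+ (≤⇒≼ (takeBin-time j as))
          (≼-+ (buildBin-≼ (⊆-trans (taken-⊆ j as) as⊆A))
            (≼-+ (buildBins-≼ r (suc j) (⊆-trans (left-⊆ j as) as⊆A))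
              (≤⇒≼ ℕ.≤-refl))))
      where
      h = length (taken j as)
      l = length (left j as)
      rearrange : ∀ h l r → 11 ℕ.* h ℕ.+ 11 ℕ.+ (1 ℕ.+ (11 ℕ.* l ℕ.+ 13 ℕ.* r ℕ.+ 1 ℕ.+ 1)) ≡
                            11 ℕ.* (h ℕ.+ l) ℕ.+ 13 ℕ.* (1 ℕ.+ r) ℕ.+ 1
      rearrange = ℕSolver.solve-∀

    -- Use `k ≤ K n` for the bins and `1 ≤ n` for the last step, whence `12 = 11 + 1`.
    overhead≤ : 11 ℕ.* n ℕ.+ 13 ℕ.* k ℕ.+ 1 ℕ.≤ (12 ℕ.+ 13 ℕ.* K) ℕ.* n
    overhead≤ = ℕ.≤-trans
      (ℕ.+-mono-≤ (ℕ.+-monoʳ-≤ (11 ℕ.* n) (ℕ.*-monoʳ-≤ 13 k≤Kn)) (s≤s z≤n))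
      (ℕ.≤-reflexive (rearrange n K))
      where
      rearrange : ∀ n K → 11 ℕ.* n ℕ.+ 13 ℕ.* (K ℕ.* n) ℕ.+ n ≡ (12 ℕ.+ 13 ℕ.* K) ℕ.* n
      rearrange = ℕSolver.solve-∀

    binnedBuild≤ : ι (time build) ≤ (ι (12 ℕ.+ 13 ℕ.* K) + 1#) * C * (ι n * g n)
    binnedBuild≤ = begin
      ι (time build)                              ≤⟨ bound (buildBins-≼ k 0 ⊆-refl) ⟩
      ι (11 ℕ.* length as ℕ.+ 13 ℕ.* k ℕ.+ 1) + ι (length as) * (C * g n)
                                                  ≡⟨ cong (λ m → ι (11 ℕ.* m ℕ.+ 13 ℕ.* k ℕ.+ 1) + ι m * (C * g n)) (length-tabulate A) ⟩
      ι (11 ℕ.* n ℕ.+ 13 ℕ.* k ℕ.+ 1) + ι n * (C * g n)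
                                                  ≤⟨ +-monoˡ-≤ _ (ι-mono-≤ overhead≤) ⟩
      ι (L ℕ.* n) + ι n * (C * g n)               ≈⟨ +-congʳ (ι-* L n) ⟩
      ι L * ι n + ι n * (C * g n)                 ≈⟨ +-congʳ (*-comm (ι L) (ι n)) ⟩
      ι n * ι L + ι n * (C * g n)                 ≈⟨ distribˡ (ι n) (ι L) (C * g n) ⟨
      -- The overhead is now a constant `L` per element, so `1 ≤ C * g n` absorbs it.
      ι n * (ι L + C * g n)                       ≤⟨ *-monoʳ-≤-nonNeg (ι-nonNeg n) (absorb (ι-nonNeg L) 1≤Cg ≤-refl) ⟩
      ι n * ((ι L + 1#) * (C * g n))              ≈⟨ *-congˡ (*-assoc (ι L + 1#) C (g n)) ⟨
      ι n * ((ι L + 1#) * C * g n)                ≈⟨ *-swap (ι n) _ (g n) ⟩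
      (ι L + 1#) * C * (ι n * g n)                ∎
      where
      L = 12 ℕ.+ 13 ℕ.* K
      as = tabulate A

  -- Search time of the binned dictionary

  module Searching (f : ℕ → Carrier) (f-mono : NonDecreasing R f) (C : Carrier) (0≤C : 0# ≤ C)
                   (search≤ : ∀ ((S , q) : NonEmptySet U × Query U) →
                     ι (time (SD.search (value (SD.build (NonEmptySet.elements S))) (Query.key q))) ≤
                     C * f (NonEmptySet.size S))
                   (P : Instance U K) (q : Query U) where
    open Instance P
    open SortedArrayProperties array
    open BinningProperties SD array k
    open Binning SD array k
    open Query q using (key)

    -- A common upper bound for the sizes of all bins, rounded up because `f` takes natural numbers.
    size : ℕ
    size = ∣ ceiling load ∣

    0<size : 0 ℕ.< size
    0<size = <-ceiling-load 0 n k G-max G-min (s≤s z≤n) (ℕ.<-≤-trans G-max>0 (ℕ.m≤m+n G-max _))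

    1≤Cf : 1# ≤ C * f size
    1≤Cf = begin
      1#          ≤⟨ ≤-trans (1≤ι (SD.search-time (value (SD.build (A₁ ∷ []))) key)) (search≤ (singleton , q)) ⟩
      C * f 1     ≤⟨ *-monoʳ-≤-nonNeg 0≤C (f-mono 0<size) ⟩
      C * f size  ∎

    searchBin≤ : ∀ {j s} → BinOf (tabulate A) j s → ι (time (searchBin s key)) ≤ C * f size
    -- A null pointer is answered in one step, which `1≤Cf` covers.
    searchBin≤ empty                      = ≤-trans (≤-reflexive (+-identityʳ 1#)) 1≤Cf
    searchBin≤ (built {x} {xs} xs⊆A bins) = begin
      ι (time (SD.search (value (SD.build (x ∷ xs))) key))
                                ≤⟨ search≤ (subset (λ ()) xs⊆A , q) ⟩
      C * f (suc (length xs))   ≤⟨ *-monoʳ-≤-nonNeg 0≤C (f-mono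
                                     (<-ceiling-load (length xs) n k G-max G-min (size≤n xs⊆A) (bin-size xs⊆A bins))) ⟩
      C * f size                ∎

    binnedSearch≤ : ι (time (search (value build) key)) ≤ (ι 10 + 1#) * C * f size
    binnedSearch≤ = begin
      -- 9 steps for the bin index and 1 for the array access. A key outside the range is clamped to
      -- some bin, and the bound holds for every bin.
      ι (10 ℕ.+ t)                   ≈⟨ ι-+ 10 t ⟩
      ι 10 + ι t                     ≤⟨ absorb (ι-nonNeg 10) 1≤Cf (searchBin≤ (lookup-buildBins k 0 (tabulate A) (bin key))) ⟩
      (ι 10 + 1#) * (C * f size)     ≈⟨ *-assoc (ι 10 + 1#) C (f size) ⟨
      (ι 10 + 1#) * C * f size       ∎
      where t = time (searchBin (lookup (value build) (bin key)) key)

theorem1 : ∀ {c ℓ₁ ℓ₂} (R : OrderedRing c ℓ₁ ℓ₂) → let open OrderedRing R in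
    (U : Pred ℤ Level.zero) (SD : Dictionary U) (f g : ℕ → Carrier) →
    NonDecreasing R f →
    Convex R g →
    NonDecreasing R g →
    BuildTime R SD (λ m → ι m * g m) →
    SearchTime R SD f →
    ∀ (K : ℕ) →
    BinnedBuildTime R SD K (λ P → ι (Instance.n P) * g (Instance.n P))
    × BinnedSearchTime R SD K (λ P → f ∣ ceiling (Instance.load P) ∣)
theorem1 R U SD f g f-mono _ g-mono (C , 0≤C , build≤) (D , 0≤D , search≤) K =
  (_ , *-nonNeg (ι+1-nonNeg (12 ℕ.+ 13 ℕ.* K)) 0≤C , Building.binnedBuild≤ g g-mono C 0≤C build≤) ,
  (_ , *-nonNeg (ι+1-nonNeg 10) 0≤D , λ (P , q) → Searching.binnedSearch≤ f f-mono D 0≤D search≤ P q)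
  where
  open OrderedRing R
  open OrderedRingProperties R
  open BinnedTimes R SD K
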